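{- Let $H=(V,E)$ be a hypergraph with associated polymatroid $P_H$, and let $e\in E$. Then $$P_{H\setminus e}=P_H\setminus e\qquad\text{and}\qquad P_{H/e}\cong P_H/e,$$ where $\cong$ denotes isomorphism of polymatroids (a groundset bijection preserving the rank function), the left-hand operations are hypergraph deletion and contraction and the right-hand operations are polymatroid deletion and contraction.
   Context: A hypergraph is a pair $H=(V,E)$ where $V$ is a finite set and $E$ is a finite multiset (parallel hyperedges are allowed and treated as distinct elements of $E$) of multisets of elements of $V$, called hyperedges. Every hyperedge has size (counted with multiplicity) greater than $1$. Write $v(H)=|V|$. $\kappa(H)$ is the number of connected components of the bipartite incidence graph with vertex classes $V$ and $E$, in which $u\in V$ and $e\in E$ are joined by as many edges as the multiplicity of $u$ in $e$. For $A\subseteq E$ let $\kappa_H(A)=\kappa((V,A))$. Hypergraph deletion: $H\setminus e=(V,E\setminus\{e\})$. Hypergraph contraction: $H/e=(V',E')$ with $V'=(V\setminus e)\cup\{v_e\}$ (all vertices occurring in $e$ are removed and one new vertex $v_e$ is added) and $E'=\{f':f\in E\setminus\{e\}\}$, where $f'$ is obtained from $f$ by replacing every occurrence (with multiplicity) of a vertex of $e$ by $v_e$. A polymatroid is a pair $P=(E,r)$ with $E$ finite and $r:2^E\to\mathbb{Z}$ normalized ($r(\emptyset)=0$), increasing and submodular. Polymatroid deletion: $P\setminus e=(E\setminus\{e\},r|_{2^{E\setminus\{e\}}})$; contraction: $P/e=(E\setminus\{e\},r')$ with $r'(X)=r(X\cup\{e\})-r(\{e\})$. The associated polymatroid $P_H$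 of $H$ has groundset $E$ and rank function $r(A)=v(H)-\kappa_H(A)$ for $A\subseteq E$ (it is known that this is a polymatroid). -}

module Defs where

open import Data.Bool.Base using (Bool; true; false; not; _∧_; _∨_; T)
open import Data.Bool.Properties using (T-∧; T-∨; T-irrelevant)
open import Data.Fin.Base using (Fin; zero; suc; punchIn; punchOut)
import Data.Fin.Properties as Finₚ
open import Data.Integer.Base as ℤ using (ℤ; +_; 0ℤ)
import Data.Integer.Properties as ℤₚ
open import Data.Integer.Solver using () renaming (module +-*-Solver to ℤ-Solver)
open import Data.List.Base as List using (List; []; _∷_; _++_; length; map; concatMap)
import Data.List.Properties as Listₚ
open import Data.List.Membership.Propositional using (_∈_; lose; find)
open import Data.List.Membership.Propositional.Properties
  using (∈-map⁺; ∈-map⁻; ∈-++⁺ˡ; ∈-++⁺ʳ; ∈-++⁻; ∈-allFin; ∈-concatMap⁺; ∈-concatMap⁻)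
import Data.List.Membership.DecPropositional as DecMembership
open import Data.List.Relation.Unary.Any using (here; there)
open import Data.Nat.Solver using () renaming (module +-*-Solver to ℕ-Solver)
open import Data.Nat.Base as ℕ using (ℕ; zero; suc)
import Data.Nat.Properties as ℕₚ
open import Data.Product.Base using (Σ; ∃; _×_; _,_; proj₁; proj₂)
open import Data.Product.Function.Dependent.Propositional using (Σ-↔)
open import Data.Sum.Base using (_⊎_; inj₁; inj₂; [_,_]′)
open import Data.Sum.Function.Propositional using (_⊎-↔_)
open import Data.Unit.Base using (⊤; tt)
open import Function.Base using (_∘_; id)
open import Function.Bundles using (_↔_; mk↔ₛ′; Inverse; Equivalence)
open import Function.Construct.Composition using (_↔-∘_)
open import Function.Construct.Identity using (↔-id)
open import Function.Construct.Symmetry using (↔-sym)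
open import Function.Properties.Inverse using (↔⇒↣)
open import Relation.Binary.Construct.Closure.Equivalence as EqC using (EqClosure)
open import Relation.Binary.Definitions using (DecidableEquality)
open import Relation.Binary.PropositionalEquality
  using (_≡_; _≢_; refl; sym; trans; cong; cong₂; subst; isEquivalence; module ≡-Reasoning)
open import Relation.Nullary.Decidable using (Dec; yes; no; isYes; T?; via-injection)
open import Relation.Nullary.Negation using (contradiction)

record FiniteSet : Set₁ where
  field
    Carrier : Set
    size    : ℕ
    enum    : Carrier ↔ Fin size

  elements : List Carrier
  elements = map (Inverse.from enum) (List.allFin size)

  infix 4 _≟_
  _≟_ : DecidableEquality Carrier
  _≟_ = via-injection (↔⇒↣ enum) Finₚ._≟_

  ∈-elements : ∀ x → x ∈ elements
  ∈-elements x = subst (_∈ elements) (Inverse.strictlyInverseʳ enum x)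
    (∈-map⁺ (Inverse.from enum) (∈-allFin (Inverse.to enum x)))

open FiniteSet using (Carrier; size; elements)

⊤ᶠ : FiniteSet
⊤ᶠ = record { Carrier = ⊤ ; size = 1 ; enum = ↔-sym Finₚ.1↔⊤ }

infixr 1 _⊎ᶠ_
_⊎ᶠ_ : FiniteSet → FiniteSet → FiniteSet
A ⊎ᶠ B = record
  { Carrier = Carrier A ⊎ Carrier B
  ; size    = size A ℕ.+ size B
  ; enum    = ↔-sym Finₚ.+↔⊎ ↔-∘ (FiniteSet.enum A ⊎-↔ FiniteSet.enum B)
  }

Subset : Set → Set
Subset X = X → Bool

module _ {X : Set} where

  infix 4 _⊆_
  infixr 7 _∩_
  infixr 6 _∪_

  _⊆_ : Subset X → Subset X → Set
  A ⊆ B = ∀ x → T (A x) → T (B x)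

  ∅ : Subset X
  ∅ _ = false

  ∁ : Subset X → Subset X
  ∁ A x = not (A x)

  _∪_ _∩_ : Subset X → Subset X → Subset X
  (A ∪ B) x = A x ∨ B x
  (A ∩ B) x = A x ∧ B x

∃T-suc : ∀ {n} (A : Fin (suc n) → Bool) →
         ∃ (T ∘ A) ↔ (T (A zero) ⊎ ∃ (T ∘ A ∘ suc))
∃T-suc A = mk↔ₛ′
  (λ { (zero , p) → inj₁ p ; (suc i , p) → inj₂ (i , p) })
  (λ { (inj₁ p) → zero , p ; (inj₂ (i , p)) → suc i , p })
  (λ { (inj₁ _) → refl ; (inj₂ _) → refl })
  (λ { (zero , _) → refl ; (suc _ , _) → refl })

∣_∣ᵇ : Bool → ℕ
∣ true  ∣ᵇ = 1
∣ false ∣ᵇ = 0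

T↔Fin : ∀ b → T b ↔ Fin ∣ b ∣ᵇ
T↔Fin true  = ↔-sym Finₚ.1↔⊤
T↔Fin false = ↔-sym Finₚ.0↔⊥

countFin : ∀ {n} → (Fin n → Bool) → ℕ
countFin {zero}  A = 0
countFin {suc n} A = ∣ A zero ∣ᵇ ℕ.+ countFin (A ∘ suc)

enumFin : ∀ {n} (A : Fin n → Bool) → ∃ (T ∘ A) ↔ Fin (countFin A)
enumFin {zero}  A = mk↔ₛ′ (λ ()) (λ ()) (λ ()) (λ ())
enumFin {suc n} A =
  ↔-sym Finₚ.+↔⊎ ↔-∘ ((T↔Fin (A zero) ⊎-↔ enumFin (A ∘ suc)) ↔-∘ ∃T-suc A)

-- A subset of a finite set, as a finite set in its own right.  Elements are
-- pairs of an element of the ambient set and a proof of membership; such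
-- proofs are unique, so the first projection is injective.
infixl 7 _↾_
_↾_ : (E : FiniteSet) → Subset (Carrier E) → FiniteSet
E ↾ A = record
  { Carrier = ∃ (T ∘ A)
  ; size    = countFin (A ∘ Inverse.from enum)
  ; enum    = enumFin (A ∘ Inverse.from enum) ↔-∘ ↔-sym
      (Σ-↔ {A = T ∘ A ∘ Inverse.from enum} {B = T ∘ A} (↔-sym enum) (↔-id _))
  }
  where open FiniteSet E using (enum)

-- A subset of the subset B, as a subset of the ambient set.
↑[_] : {X : Set} (B : Subset X) → Subset (∃ (T ∘ B)) → Subset X
↑[ B ] A x with T? (B x)
... | yes x∈B = A (x , x∈B)
... | no  _   = false

module _ (E : FiniteSet) where

  open FiniteSet E using (_≟_)

  singleton : Carrier E → Subset (Carrier E)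
  singleton e x = isYes (x ≟ e)

  without : Carrier E → Subset (Carrier E)
  without e = ∁ (singleton e)

infixl 7 _-ᶠ_
_-ᶠ_ : (E : FiniteSet) → Carrier E → FiniteSet
E -ᶠ e = E ↾ without E e

-- A multiset of edges, each given by its two ends.
Multigraph : Set → Set
Multigraph X = List (X × X)

module _ {X : Set} (G : Multigraph X) where

  Adjacent : X → X → Set
  Adjacent x y = (x , y) ∈ G

  Connected : X → X → Set
  Connected = EqClosure Adjacent

  record Components : Set where
    field
      count      : ℕ
      class      : X → Fin count
      surjective : ∀ i → ∃ λ x → class x ≡ i
      complete   : ∀ {x y} → Connected x y → class x ≡ class y
      sound      : ∀ {x y} → class x ≡ class y → Connected x y

open Components using (count)

-- Identifying two distinct elements of Fin (suc n).
module Merge {n} (i j : Fin (suc n)) (i≢j : i ≢ j) where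

  redirect : Fin (suc n) → Fin (suc n)
  redirect a with a Finₚ.≟ j
  ... | yes _ = i
  ... | no  _ = a

  j≢redirect : ∀ a → j ≢ redirect a
  j≢redirect a with a Finₚ.≟ j
  ... | yes _   = i≢j ∘ sym
  ... | no  a≢j = a≢j ∘ sym

  redirect-j : redirect j ≡ i
  redirect-j with j Finₚ.≟ j
  ... | yes _   = refl
  ... | no  j≢j = contradiction refl j≢j

  redirect-≢ : ∀ {a} → a ≢ j → redirect a ≡ a
  redirect-≢ {a} a≢j with a Finₚ.≟ j
  ... | yes a≡j = contradiction a≡j a≢j
  ... | no  _   = refl

  merge : Fin (suc n) → Fin n
  merge a = punchOut (j≢redirect a)

  merge-glues : merge i ≡ merge j
  merge-glues = Finₚ.punchOut-cong j (trans (redirect-≢ i≢j) (sym redirect-j))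

  merge-surjective : ∀ b → ∃ λ a → merge a ≡ b
  merge-surjective b = punchIn j b , trans
    (Finₚ.punchOut-cong j (redirect-≢ (Finₚ.punchInᵢ≢i j b)))
    (Finₚ.punchOut-punchIn j)

  redirect-kernel : ∀ a b → redirect a ≡ redirect b →
                    a ≡ b ⊎ (a ≡ i × b ≡ j) ⊎ (a ≡ j × b ≡ i)
  redirect-kernel a b eq with a Finₚ.≟ j | b Finₚ.≟ j
  ... | yes p | yes q = inj₁ (trans p (sym q))
  ... | yes p | no  _ = inj₂ (inj₂ (p , sym eq))
  ... | no  _ | yes q = inj₂ (inj₁ (eq , q))
  ... | no  _ | no  _ = inj₁ eq

  merge-kernel : ∀ a b → merge a ≡ merge b →
                 a ≡ b ⊎ (a ≡ i × b ≡ j) ⊎ (a ≡ j × b ≡ i)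
  merge-kernel a b eq = redirect-kernel a b
    (Finₚ.punchOut-injective (j≢redirect a) (j≢redirect b) eq)

module _ {X : Set} where

  connected-⊆ : {G G′ : Multigraph X} → (∀ {p} → p ∈ G → p ∈ G′) →
                ∀ {x y} → Connected G x y → Connected G′ x y
  connected-⊆ sub = EqC.map sub

  Connected-sym : (G : Multigraph X) → ∀ {x y} → Connected G x y → Connected G y x
  Connected-sym G = EqC.symmetric (Adjacent G)

  Connected-trans : (G : Multigraph X) → ∀ {x y z} →
                    Connected G x y → Connected G y z → Connected G x z
  Connected-trans G = EqC.transitive (Adjacent G)

  addInner : {G : Multigraph X} {u v : X} (C : Components G) →
             Components.class C u ≡ Components.class C v →
             Components ((u , v) ∷ G)
  addInner {G} {u} {v} C eq = record
    { count      = C.count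
    ; class      = C.class
    ; surjective = C.surjective
    ; complete   = EqC.gfold isEquivalence C.class
        (λ { (here refl) → eq ; (there p) → C.complete (EqC.return p) })
    ; sound      = connected-⊆ there ∘ C.sound
    }
    where module C = Components C

  addOuter : {G : Multigraph X} {u v : X} (C : Components G) →
             Components.class C u ≢ Components.class C v →
             Σ (Components ((u , v) ∷ G)) λ C′ → count C ≡ suc (count C′)
  addOuter {G} {u} {v} record { count = zero ; class = class } _ with class u
  ... | ()
  addOuter {G} {u} {v} C@record { count = suc n } u≢v = record
    { count      = n
    ; class      = M.merge ∘ C.class
    ; surjective = λ b → let a , ma≡b = M.merge-surjective b
                             x , cx≡a = C.surjective a
                         in x , trans (cong M.merge cx≡a) ma≡b
    ; complete   = EqC.gfold isEquivalence (M.merge ∘ C.class)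
        (λ { (here refl) → M.merge-glues
           ; (there p)   → cong M.merge (C.complete (EqC.return p)) })
    ; sound      = λ {x} {y} eq →
        [ lift , [ (λ (p , q) → trans′ (lift p) (trans′ uv (lift (sym q))))
                 , (λ (p , q) → trans′ (lift p) (trans′ (sym′ uv) (lift (sym q))))
                 ]′ ]′ (M.merge-kernel (C.class x) (C.class y) eq)
    } , refl
    where
    module C = Components C
    module M = Merge (C.class u) (C.class v) u≢v
    G⁺ = (u , v) ∷ G
    trans′ : ∀ {x y z} → Connected G⁺ x y → Connected G⁺ y z → Connected G⁺ x z
    trans′ = Connected-trans G⁺
    sym′ : ∀ {x y} → Connected G⁺ x y → Connected G⁺ y x
    sym′ = Connected-sym G⁺
    lift : ∀ {x y} → C.class x ≡ C.class y → Connected G⁺ x y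
    lift = connected-⊆ there ∘ C.sound
    uv : Connected G⁺ u v
    uv = EqC.return (here refl)

discrete : (V : FiniteSet) → Components {Carrier V} []
discrete V = record
  { count      = size V
  ; class      = to
  ; surjective = λ i → from i , strictlyInverseˡ i
  ; complete   = EqC.gfold isEquivalence to (λ ())
  ; sound      = λ {x} {y} eq →
      subst (Connected [] x)
        (trans (sym (strictlyInverseʳ x))
               (trans (cong from eq) (strictlyInverseʳ y)))
        (EqC.reflexive (Adjacent []))
  }
  where open Inverse (FiniteSet.enum V)

module _ (V : FiniteSet) where

  components : (G : Multigraph (Carrier V)) → Components G
  extend     : ∀ {G u v} (C : Components G) → Dec (Components.class C u ≡ Components.class C v) →
               Components {Carrier V} ((u , v) ∷ G)

  components []            = discrete V
  components ((u , v) ∷ G) = extend (components G)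
    (Components.class (components G) u Finₚ.≟ Components.class (components G) v)

  extend C (yes eq) = addInner C eq
  extend C (no neq) = proj₁ (addOuter C neq)

  #components : Multigraph (Carrier V) → ℕ
  #components G = count (components G)

-- The number of components depends only on connectivity.

module _ {X Y : Set} {G : Multigraph X} {G′ : Multigraph Y}
         (C : Components G) (C′ : Components G′) where

  private
    module C  = Components C
    module C′ = Components C′

  count-≤ : (f : X → Y) → (∀ {x y} → Adjacent G x y → Connected G′ (f x) (f y)) →
            (∀ y → ∃ λ x → Connected G′ (f x) y) → C′.count ℕ.≤ C.count
  count-≤ f f-adj f-onto = Finₚ.injective⇒≤ {f = C.class ∘ pre} pre-injective
    where
    rep : ∀ i → Y
    rep = proj₁ ∘ C′.surjective
    pre : ∀ i → X
    pre = proj₁ ∘ f-onto ∘ rep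
    f-conn : ∀ {x y} → Connected G x y → Connected G′ (f x) (f y)
    f-conn = EqC.gfold (EqC.isEquivalence (Adjacent G′)) f f-adj
    class-pre : ∀ i → C′.class (f (pre i)) ≡ i
    class-pre i = trans (C′.complete (proj₂ (f-onto (rep i)))) (proj₂ (C′.surjective i))
    pre-injective : ∀ {i j} → C.class (pre i) ≡ C.class (pre j) → i ≡ j
    pre-injective {i} {j} eq = trans (sym (class-pre i))
      (trans (C′.complete (f-conn (C.sound eq))) (class-pre j))

-- Adding edges decreases the number of components of a sparser graph at
-- least as much as that of a denser one.

module _ (V : FiniteSet) where

  private
    # : Multigraph (Carrier V) → ℕ
    # = #components V

    class : ∀ G → Carrier V → Fin (# G)
    class G = Components.class (components V G)

  _≼_ : Multigraph (Carrier V) → Multigraph (Carrier V) → Set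
  G ≼ G′ = ∀ {x y} → Adjacent G x y → Connected G′ x y

  #-antitone : ∀ {G G′} → G ≼ G′ → # G′ ℕ.≤ # G
  #-antitone {G} {G′} G≼G′ = count-≤ (components V G) (components V G′) id G≼G′
    (λ y → y , EqC.reflexive (Adjacent G′))

  #-inner : ∀ G u v → class G u ≡ class G v → # ((u , v) ∷ G) ≡ # G
  #-inner G u v eq with class G u Finₚ.≟ class G v
  ... | yes _  = refl
  ... | no neq = contradiction eq neq

  #-outer : ∀ G u v → class G u ≢ class G v → # G ≡ suc (# ((u , v) ∷ G))
  #-outer G u v neq with class G u Finₚ.≟ class G v
  ... | yes eq  = contradiction eq neq
  ... | no neq′ = proj₂ (addOuter (components V G) neq′)

  #-step : ∀ {G G′} → G ≼ G′ → ∀ p → # G′ ℕ.+ # (p ∷ G) ℕ.≤ # G ℕ.+ # (p ∷ G′)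
  #-step {G} {G′} G≼G′ (u , v) with class G′ u Finₚ.≟ class G′ v
  ... | yes eq = begin
    # G′ ℕ.+ # ((u , v) ∷ G)  ≤⟨ ℕₚ.+-monoʳ-≤ (# G′) (#-antitone there′) ⟩
    # G′ ℕ.+ # G              ≡⟨ ℕₚ.+-comm (# G′) (# G) ⟩
    # G ℕ.+ # G′              ∎
    where
    open ℕₚ.≤-Reasoning
    there′ : G ≼ ((u , v) ∷ G)
    there′ = EqC.return ∘ there
  ... | no neq = ℕₚ.≤-reflexive (begin
    # G′ ℕ.+ # ((u , v) ∷ G)       ≡⟨ cong (ℕ._+ # ((u , v) ∷ G)) eq′ ⟩
    suc c′ ℕ.+ # ((u , v) ∷ G)     ≡⟨ ℕₚ.+-suc c′ _ ⟨
    c′ ℕ.+ suc (# ((u , v) ∷ G))   ≡⟨ cong (c′ ℕ.+_) (#-outer G u v neq-G) ⟨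
    c′ ℕ.+ # G                     ≡⟨ ℕₚ.+-comm c′ (# G) ⟩
    # G ℕ.+ c′                     ∎)
    where
    open ≡-Reasoning
    added = addOuter (components V G′) neq
    c′ = count (proj₁ added)
    eq′ : # G′ ≡ suc c′
    eq′ = proj₂ added
    neq-G : class G u ≢ class G v
    neq-G eq = neq (Components.complete (components V G′)
      (EqC._⋆ G≼G′ (Components.sound (components V G) eq)))

  ++-≼ : ∀ F {G G′} → G ≼ G′ → (F ++ G) ≼ (F ++ G′)
  ++-≼ F {G} {G′} G≼G′ p with ∈-++⁻ F p
  ... | inj₁ q = EqC.return (∈-++⁺ˡ q)
  ... | inj₂ q = EqC.map (∈-++⁺ʳ F) (G≼G′ q)

  #-submodular : ∀ {G G′} → G ≼ G′ → ∀ F →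
                 # G′ ℕ.+ # (F ++ G) ℕ.≤ # G ℕ.+ # (F ++ G′)
  #-submodular {G} {G′} G≼G′ []      = ℕₚ.≤-reflexive (ℕₚ.+-comm (# G′) (# G))
  #-submodular {G} {G′} G≼G′ (p ∷ F) =
    chain (# G′) (# (p ∷ F ++ G)) (# (F ++ G)) (# (F ++ G′)) (# G) (# (p ∷ F ++ G′))
      (#-submodular G≼G′ F) (#-step (++-≼ F G≼G′) p)
    where
    open ℕₚ.≤-Reasoning
    chain : ∀ a b c d e f → a ℕ.+ c ℕ.≤ e ℕ.+ d → d ℕ.+ b ℕ.≤ c ℕ.+ f →
            a ℕ.+ b ℕ.≤ e ℕ.+ f
    chain a b c d e f h₁ h₂ = ℕₚ.+-cancelˡ-≤ (c ℕ.+ d) _ _ (begin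
      (c ℕ.+ d) ℕ.+ (a ℕ.+ b)  ≡⟨ solve 4 (λ a b c d → (c :+ d) :+ (a :+ b) := (a :+ c) :+ (d :+ b)) refl a b c d ⟩
      (a ℕ.+ c) ℕ.+ (d ℕ.+ b)  ≤⟨ ℕₚ.+-mono-≤ h₁ h₂ ⟩
      (e ℕ.+ d) ℕ.+ (c ℕ.+ f)  ≡⟨ solve 4 (λ c d e f → (e :+ d) :+ (c :+ f) := (c :+ d) :+ (e :+ f)) refl c d e f ⟩
      (c ℕ.+ d) ℕ.+ (e ℕ.+ f)  ∎)
      where open ℕ-Solver

-- A multiset of vertices is a list of its elements with repetition; every
-- notion below is independent of the order.  The multiset of hyperedges is
-- a family indexed by E, so that parallel hyperedges are distinct elements
-- of E.
record Hypergraph (V E : FiniteSet) : Set where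
  field
    edge    : Carrier E → List (Carrier V)
    nonLoop : ∀ f → 1 ℕ.< length (edge f)

open Hypergraph public

v : {V E : FiniteSet} → Hypergraph V E → ℕ
v {V} _ = size V

incidenceGraph : {V E : FiniteSet} → Hypergraph V E → Multigraph (Carrier V ⊎ Carrier E)
incidenceGraph {V} {E} H =
  concatMap (λ f → map (λ u → inj₁ u , inj₂ f) (edge H f)) (elements E)

κ : {V E : FiniteSet} → Hypergraph V E → ℕ
κ {V} {E} H = #components (V ⊎ᶠ E) (incidenceGraph H)

-- The hypergraph (V , A).
infixl 6 _∣_
_∣_ : {V E : FiniteSet} → Hypergraph V E → (A : Subset (Carrier E)) → Hypergraph V (E ↾ A)
H ∣ A = record
  { edge    = edge H ∘ proj₁
  ; nonLoop = nonLoop H ∘ proj₁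
  }

infixl 6 _∖_
_∖_ : {V E : FiniteSet} → Hypergraph V E → (e : Carrier E) → Hypergraph V (E -ᶠ e)
_∖_ {E = E} H e = H ∣ without E e

module _ {V E : FiniteSet} (H : Hypergraph V E) (e : Carrier E) where

  open DecMembership (FiniteSet._≟_ V) using (_∈?_)

  support : Subset (Carrier V)
  support u = isYes (u ∈? edge H e)

  -- (V ∖ e) ∪ { vₑ }, where vₑ is inj₂ tt
  contractedVertices : FiniteSet
  contractedVertices = (V ↾ ∁ support) ⊎ᶠ ⊤ᶠ

  collapse : Carrier V → Carrier contractedVertices
  collapse u with T? (∁ support u)
  ... | yes u∉e = inj₁ (u , u∉e)
  ... | no  _   = inj₂ tt

infixl 6 _/_
_/_ : {V E : FiniteSet} (H : Hypergraph V E) (e : Carrier E) →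
      Hypergraph (contractedVertices H e) (E -ᶠ e)
H / e = record
  { edge    = λ (f , _) → map (collapse H e) (edge H f)
  ; nonLoop = λ (f , _) → subst (1 ℕ.<_)
      (sym (Listₚ.length-map (collapse H e) (edge H f))) (nonLoop H f)
  }

-- `increasing` implies that `rank` respects mutual inclusion, so `rank`
-- is a function of sets.
record Polymatroid (E : FiniteSet) : Set where
  field
    rank       : Subset (Carrier E) → ℤ
    normalized : rank ∅ ≡ 0ℤ
    increasing : ∀ A B → A ⊆ B → rank A ℤ.≤ rank B
    submodular : ∀ A B → rank (A ∪ B) ℤ.+ rank (A ∩ B) ℤ.≤ rank A ℤ.+ rank B

  rank-cong : ∀ A B → A ⊆ B → B ⊆ A → rank A ≡ rank B
  rank-cong A B A⊆B B⊆A = ℤₚ.≤-antisym (increasing A B A⊆B) (increasing B A B⊆A)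

open Polymatroid using (rank)

-- Equality of polymatroids: the groundsets agree by typing.
infix 4 _≐_
_≐_ : {E : FiniteSet} → Polymatroid E → Polymatroid E → Set
P ≐ Q = ∀ A → rank P A ≡ rank Q A

-- y lies in φ(A) if and only if φ⁻¹(y) lies in A.
image : {X Y : Set} → X ↔ Y → Subset X → Subset Y
image φ A = A ∘ Inverse.from φ

infix 4 _≅_
_≅_ : {E F : FiniteSet} → Polymatroid E → Polymatroid F → Set
_≅_ {E} {F} P Q = Σ (Carrier E ↔ Carrier F) λ φ →
  ∀ A → rank P A ≡ rank Q (image φ A)

module _ {X : Set} (B : Subset X) where

  ∈-↑⁻ : ∀ A x → T (↑[ B ] A x) → ∃ λ (p : T (B x)) → T (A (x , p))
  ∈-↑⁻ A x x∈A with T? (B x)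
  ... | yes p = p , x∈A

  ∈-↑⁺ : ∀ A x (p : T (B x)) → T (A (x , p)) → T (↑[ B ] A x)
  ∈-↑⁺ A x p x∈A with T? (B x)
  ... | yes q = subst (λ r → T (A (x , r))) (T-irrelevant p q) x∈A
  ... | no ¬q = contradiction p ¬q

  ↑-∅ : ↑[ B ] ∅ ⊆ ∅
  ↑-∅ x x∈ = proj₂ (∈-↑⁻ ∅ x x∈)

  ↑-⊆ : ∀ A A′ → A ⊆ A′ → ↑[ B ] A ⊆ ↑[ B ] A′
  ↑-⊆ A A′ sub x x∈ = let p , x∈A = ∈-↑⁻ A x x∈ in ∈-↑⁺ A′ x p (sub _ x∈A)

  ↑-∪ : ∀ A A′ → ↑[ B ] (A ∪ A′) ⊆ ↑[ B ] A ∪ ↑[ B ] A′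
  ↑-∪ A A′ x x∈ with ∈-↑⁻ (A ∪ A′) x x∈
  ... | p , q = T-∨ {↑[ B ] A x} .Equivalence.from
    ([ inj₁ ∘ ∈-↑⁺ A x p , inj₂ ∘ ∈-↑⁺ A′ x p ]′
      (T-∨ {A (x , p)} .Equivalence.to q))

  ↑-∩ : ∀ A A′ → ↑[ B ] (A ∩ A′) ⊆ ↑[ B ] A ∩ ↑[ B ] A′
  ↑-∩ A A′ x x∈ with ∈-↑⁻ (A ∩ A′) x x∈
  ... | p , q = let a , b = T-∧ {A (x , p)} .Equivalence.to q in
    T-∧ {↑[ B ] A x} .Equivalence.from (∈-↑⁺ A x p a , ∈-↑⁺ A′ x p b)

module _ {X : Set} where

  ⊆-∪ˡ : (A B : Subset X) → A ⊆ A ∪ B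
  ⊆-∪ˡ A B x a = T-∨ {A x} .Equivalence.from (inj₁ a)

  ⊆-∪ʳ : (A B : Subset X) → B ⊆ A ∪ B
  ⊆-∪ʳ A B x b = T-∨ {A x} .Equivalence.from (inj₂ b)

  ∪-⊆ : (A B C : Subset X) → A ⊆ C → B ⊆ C → A ∪ B ⊆ C
  ∪-⊆ A B C f g x p = [ f x , g x ]′ (T-∨ {A x} .Equivalence.to p)

  ∩-⊆ˡ : (A B : Subset X) → A ∩ B ⊆ A
  ∩-⊆ˡ A B x p = proj₁ (T-∧ {A x} .Equivalence.to p)

  ∩-⊆ʳ : (A B : Subset X) → A ∩ B ⊆ B
  ∩-⊆ʳ A B x p = proj₂ (T-∧ {A x} .Equivalence.to p)

  ⊆-∩ : (A B C : Subset X) → C ⊆ A → C ⊆ B → C ⊆ A ∩ B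
  ⊆-∩ A B C f g x p = T-∧ {A x} .Equivalence.from (f x p , g x p)

spokes⁺ : (F : FiniteSet) {B : Set} (g : Carrier F → List B) →
          ∀ {b} f → b ∈ g f → b ∈ concatMap g (elements F)
spokes⁺ F g f b∈ = ∈-concatMap⁺ g (lose (FiniteSet.∈-elements F f) b∈)

spokes⁻ : (F : FiniteSet) {B : Set} (g : Carrier F → List B) →
          ∀ {b} → b ∈ concatMap g (elements F) → ∃ λ f → b ∈ g f
spokes⁻ F g b∈ = let f , _ , b∈gf = find (∈-concatMap⁻ g {xs = elements F} b∈) in f , b∈gf

module _ {V E : FiniteSet} (H : Hypergraph V E) where

  private
    Γ = incidenceGraph H
    g : (f : Carrier E) → Multigraph (Carrier V ⊎ Carrier E)
    g f = map (λ u → inj₁ u , inj₂ f) (edge H f)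

  incident⁺ : ∀ {u f} → u ∈ edge H f → Adjacent Γ (inj₁ u) (inj₂ f)
  incident⁺ {f = f} u∈f = spokes⁺ E g f (∈-map⁺ _ u∈f)

  incident⁻ : ∀ {p} → p ∈ Γ → ∃ λ f → ∃ λ u → u ∈ edge H f × p ≡ (inj₁ u , inj₂ f)
  incident⁻ p∈Γ = let f , p∈gf = spokes⁻ E g p∈Γ in f , ∈-map⁻ _ p∈gf

  hub : ∀ f → ∃ (_∈ edge H f)
  hub f with edge H f | nonLoop H f
  ... | u ∷ _ | _ = u , here refl

  -- A graph on V with the same connectivity: each hyperedge f is replaced
  -- by edges from a fixed element of f to all elements of f.
  starGraph : Multigraph (Carrier V)
  starGraph = concatMap (λ f → map (proj₁ (hub f) ,_) (edge H f)) (elements E)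

  star⁺ : ∀ f {u} → u ∈ edge H f → Adjacent starGraph (proj₁ (hub f)) u
  star⁺ f u∈f = spokes⁺ E _ f (∈-map⁺ _ u∈f)

  star⁻ : ∀ {p} → p ∈ starGraph → ∃ λ f → ∃ λ u → u ∈ edge H f × p ≡ (proj₁ (hub f) , u)
  star⁻ p∈ = let f , p∈f = spokes⁻ E _ p∈ in f , ∈-map⁻ _ p∈f

  star-joins : ∀ f {u w} → u ∈ edge H f → w ∈ edge H f → Connected starGraph u w
  star-joins f u∈f w∈f = Connected-trans starGraph
    (Connected-sym starGraph (EqC.return (star⁺ f u∈f))) (EqC.return (star⁺ f w∈f))

  Γ-joins : ∀ f {u w} → u ∈ edge H f → w ∈ edge H f → Connected Γ (inj₁ u) (inj₁ w)
  Γ-joins f u∈f w∈f = Connected-trans Γ (EqC.return (incident⁺ u∈f))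
    (Connected-sym Γ (EqC.return (incident⁺ w∈f)))

  κ-star : κ H ≡ #components V starGraph
  κ-star = ℕₚ.≤-antisym
    (count-≤ (components V starGraph) (components (V ⊎ᶠ E) Γ) inj₁ to-adj to-onto)
    (count-≤ (components (V ⊎ᶠ E) Γ) (components V starGraph) retract from-adj
      (λ u → inj₁ u , EqC.reflexive (Adjacent starGraph)))
    where
    to-adj : ∀ {x y} → Adjacent starGraph x y → Connected Γ (inj₁ x) (inj₁ y)
    to-adj p with star⁻ p
    ... | f , u , u∈f , refl = Γ-joins f (proj₂ (hub f)) u∈f
    to-onto : ∀ y → ∃ λ x → Connected Γ (inj₁ x) y
    to-onto (inj₁ u) = u , EqC.reflexive (Adjacent Γ)
    to-onto (inj₂ f) = proj₁ (hub f) , EqC.return (incident⁺ (proj₂ (hub f)))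
    retract : Carrier V ⊎ Carrier E → Carrier V
    retract = [ id , proj₁ ∘ hub ]′
    from-adj : ∀ {x y} → Adjacent Γ x y → Connected starGraph (retract x) (retract y)
    from-adj p with incident⁻ p
    ... | f , u , u∈f , refl = star-joins f u∈f (proj₂ (hub f))

module _ {V E : FiniteSet} (H : Hypergraph V E) where

  private
    S : Subset (Carrier E) → Multigraph (Carrier V)
    S A = starGraph (H ∣ A)

    # : Multigraph (Carrier V) → ℕ
    # = #components V

    k : Subset (Carrier E) → ℕ
    k A = κ (H ∣ A)

  -- Edges of the star graph of A lie in any graph joining the elements of
  -- each hyperedge of A.
  star-≼ : ∀ A G → (∀ f → T (A f) → ∀ {u w} → u ∈ edge H f → w ∈ edge H f → Connected G u w) →
           _≼_ V (S A) G
  star-≼ A G joins p with star⁻ (H ∣ A) p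
  ... | (f , f∈A) , u , u∈f , refl = joins f f∈A (proj₂ (hub (H ∣ A) (f , f∈A))) u∈f

  S-mono : ∀ A B → A ⊆ B → _≼_ V (S A) (S B)
  S-mono A B A⊆B = star-≼ A (S B) (λ f f∈A → star-joins (H ∣ B) (f , A⊆B f f∈A))

  κ-∅ : κ (H ∣ ∅) ≡ v H
  κ-∅ = trans (κ-star (H ∣ ∅)) (ℕₚ.≤-antisym
    (#-antitone V {[]} {S ∅} (λ ()))
    (#-antitone V {S ∅} {[]} (star-≼ ∅ [] (λ _ ()))))

  κ-antitone : ∀ A B → A ⊆ B → κ (H ∣ B) ℕ.≤ κ (H ∣ A)
  κ-antitone A B A⊆B = begin
    k B      ≡⟨ κ-star (H ∣ B) ⟩
    # (S B)  ≤⟨ #-antitone V (S-mono A B A⊆B) ⟩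
    # (S A)  ≡⟨ κ-star (H ∣ A) ⟨
    k A      ∎
    where open ℕₚ.≤-Reasoning

  κ-supermodular : ∀ A B → κ (H ∣ A) ℕ.+ κ (H ∣ B) ℕ.≤ κ (H ∣ (A ∪ B)) ℕ.+ κ (H ∣ (A ∩ B))
  κ-supermodular A B = begin
    k A ℕ.+ k B
      ≡⟨ cong₂ ℕ._+_ (κ-star (H ∣ A)) (κ-star (H ∣ B)) ⟩
    # (S A) ℕ.+ # (S B)
      ≡⟨ ℕₚ.+-comm (# (S A)) (# (S B)) ⟩
    # (S B) ℕ.+ # (S A)
      ≤⟨ ℕₚ.+-monoʳ-≤ (# (S B)) (#-antitone V A∩B≼A) ⟩
    # (S B) ℕ.+ # (S A ++ S (A ∩ B))
      ≤⟨ #-submodular V (S-mono (A ∩ B) B (∩-⊆ʳ A B)) (S A) ⟩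
    # (S (A ∩ B)) ℕ.+ # (S A ++ S B)
      ≤⟨ ℕₚ.+-monoʳ-≤ (# (S (A ∩ B))) (#-antitone V A∪B≼) ⟩
    # (S (A ∩ B)) ℕ.+ # (S (A ∪ B))
      ≡⟨ ℕₚ.+-comm (# (S (A ∩ B))) (# (S (A ∪ B))) ⟩
    # (S (A ∪ B)) ℕ.+ # (S (A ∩ B))
      ≡⟨ cong₂ ℕ._+_ (κ-star (H ∣ (A ∪ B))) (κ-star (H ∣ (A ∩ B))) ⟨
    k (A ∪ B) ℕ.+ k (A ∩ B) ∎
    where
    open ℕₚ.≤-Reasoning
    A∩B≼A : _≼_ V (S A ++ S (A ∩ B)) (S A)
    A∩B≼A p with ∈-++⁻ (S A) p
    ... | inj₁ q = EqC.return q
    ... | inj₂ q = S-mono (A ∩ B) A (∩-⊆ˡ A B) q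
    A∪B≼ : _≼_ V (S (A ∪ B)) (S A ++ S B)
    A∪B≼ = star-≼ (A ∪ B) (S A ++ S B) λ f f∈ u∈f w∈f →
      [ (λ f∈A → EqC.map ∈-++⁺ˡ (star-joins (H ∣ A) (f , f∈A) u∈f w∈f))
      , (λ f∈B → EqC.map (∈-++⁺ʳ (S A)) (star-joins (H ∣ B) (f , f∈B) u∈f w∈f))
      ]′ (T-∨ {A f} .Equivalence.to f∈)

P⟦_⟧ : {V E : FiniteSet} → Hypergraph V E → Polymatroid E
P⟦ H ⟧ = record
  { rank       = λ A → + v H ℤ.- + κ (H ∣ A)
  ; normalized = ℤₚ.i≡j⇒i-j≡0 (cong +_ (sym (κ-∅ H)))
  ; increasing = λ A B A⊆B → ℤₚ.+-monoʳ-≤ (+ v H)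
      (ℤₚ.neg-mono-≤ (ℤ.+≤+ (κ-antitone H A B A⊆B)))
  ; submodular = λ A B → begin
      (+ v H ℤ.- + κ (H ∣ (A ∪ B))) ℤ.+ (+ v H ℤ.- + κ (H ∣ (A ∩ B)))
        ≡⟨ regroup (+ v H) (+ κ (H ∣ (A ∪ B))) (+ κ (H ∣ (A ∩ B))) ⟩
      (+ v H ℤ.+ + v H) ℤ.- (+ κ (H ∣ (A ∪ B)) ℤ.+ + κ (H ∣ (A ∩ B)))
        ≤⟨ ℤₚ.+-monoʳ-≤ (+ v H ℤ.+ + v H) (ℤₚ.neg-mono-≤ (ℤ.+≤+ (κ-supermodular H A B))) ⟩
      (+ v H ℤ.+ + v H) ℤ.- (+ κ (H ∣ A) ℤ.+ + κ (H ∣ B))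
        ≡⟨ regroup (+ v H) (+ κ (H ∣ A)) (+ κ (H ∣ B)) ⟨
      (+ v H ℤ.- + κ (H ∣ A)) ℤ.+ (+ v H ℤ.- + κ (H ∣ B)) ∎
  }
  where
  open ℤₚ.≤-Reasoning
  open ℤ-Solver using (solve; _:+_; _:-_; _:=_)
  regroup : ∀ n a b → (n ℤ.- a) ℤ.+ (n ℤ.- b) ≡ (n ℤ.+ n) ℤ.- (a ℤ.+ b)
  regroup = solve 3 (λ n a b → (n :- a) :+ (n :- b) := (n :+ n) :- (a :+ b)) refl

infixl 6 _∖ᴾ_ _/ᴾ_
_∖ᴾ_ : {E : FiniteSet} → Polymatroid E → (e : Carrier E) → Polymatroid (E -ᶠ e)
_∖ᴾ_ {E} P e = record
  { rank       = λ A → rank P (↑ A)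
  ; normalized = trans (P.rank-cong (↑ ∅) ∅ (↑-∅ (without E e)) (λ _ ())) P.normalized
  ; increasing = λ A B A⊆B → P.increasing (↑ A) (↑ B) (↑-⊆ (without E e) A B A⊆B)
  ; submodular = λ A B → ℤₚ.≤-trans
      (ℤₚ.+-mono-≤
        (P.increasing (↑ (A ∪ B)) (↑ A ∪ ↑ B) (↑-∪ (without E e) A B))
        (P.increasing (↑ (A ∩ B)) (↑ A ∩ ↑ B) (↑-∩ (without E e) A B)))
      (P.submodular (↑ A) (↑ B))
  }
  where
  module P = Polymatroid P
  ↑ = ↑[ without E e ]

_/ᴾ_ : {E : FiniteSet} → Polymatroid E → (e : Carrier E) → Polymatroid (E -ᶠ e)
_/ᴾ_ {E} P e = record
  { rank       = λ A → rank P (↑ A ∪ e̅) ℤ.- rank P e̅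
  ; normalized = ℤₚ.i≡j⇒i-j≡0 (P.rank-cong (↑ ∅ ∪ e̅) e̅
      (∪-⊆ (↑ ∅) e̅ e̅ (λ x p → contradiction (↑-∅ (without E e) x p) id) (λ _ p → p))
      (⊆-∪ʳ (↑ ∅) e̅))
  ; increasing = λ A B A⊆B → ℤₚ.+-monoˡ-≤ (ℤ.- rank P e̅)
      (P.increasing (↑ A ∪ e̅) (↑ B ∪ e̅) (⁺-mono A B A⊆B))
  ; submodular = λ A B → begin
      (r (A ∪ B) ℤ.- rank P e̅) ℤ.+ (r (A ∩ B) ℤ.- rank P e̅)
        ≡⟨ regroup (r (A ∪ B)) (r (A ∩ B)) (rank P e̅) ⟩
      (r (A ∪ B) ℤ.+ r (A ∩ B)) ℤ.- (rank P e̅ ℤ.+ rank P e̅)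
        ≤⟨ ℤₚ.+-monoˡ-≤ (ℤ.- (rank P e̅ ℤ.+ rank P e̅)) (ℤₚ.≤-trans
             (ℤₚ.+-mono-≤
               (P.increasing ((A ∪ B) ⁺) (A ⁺ ∪ B ⁺) (⁺-∪ A B))
               (P.increasing ((A ∩ B) ⁺) (A ⁺ ∩ B ⁺)
                 (⊆-∩ (A ⁺) (B ⁺) ((A ∩ B) ⁺)
                   (⁺-mono (A ∩ B) A (∩-⊆ˡ A B)) (⁺-mono (A ∩ B) B (∩-⊆ʳ A B)))))
             (P.submodular (A ⁺) (B ⁺))) ⟩
      (r A ℤ.+ r B) ℤ.- (rank P e̅ ℤ.+ rank P e̅)
        ≡⟨ regroup (r A) (r B) (rank P e̅) ⟨
      (r A ℤ.- rank P e̅) ℤ.+ (r B ℤ.- rank P e̅) ∎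
  }
  where
  open ℤₚ.≤-Reasoning
  open ℤ-Solver using (solve; _:+_; _:-_; _:=_)
  module P = Polymatroid P
  ↑ = ↑[ without E e ]
  e̅ = singleton E e
  _⁺ : Subset (Carrier (E -ᶠ e)) → Subset (Carrier E)
  A ⁺ = ↑ A ∪ e̅
  r : Subset (Carrier (E -ᶠ e)) → ℤ
  r A = rank P (A ⁺)
  ⁺-mono : ∀ A B → A ⊆ B → A ⁺ ⊆ B ⁺
  ⁺-mono A B A⊆B = ∪-⊆ (↑ A) e̅ (B ⁺)
    (λ x → ⊆-∪ˡ (↑ B) e̅ x ∘ ↑-⊆ (without E e) A B A⊆B x) (⊆-∪ʳ (↑ B) e̅)
  ⁺-∪ : ∀ A B → (A ∪ B) ⁺ ⊆ A ⁺ ∪ B ⁺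
  ⁺-∪ A B = ∪-⊆ (↑ (A ∪ B)) e̅ (A ⁺ ∪ B ⁺)
    (λ x → ∪-⊆ (↑ A) (↑ B) (A ⁺ ∪ B ⁺)
       (λ y → ⊆-∪ˡ (A ⁺) (B ⁺) y ∘ ⊆-∪ˡ (↑ A) e̅ y)
       (λ y → ⊆-∪ʳ (A ⁺) (B ⁺) y ∘ ⊆-∪ˡ (↑ B) e̅ y) x ∘ ↑-∪ (without E e) A B x)
    (λ x → ⊆-∪ˡ (A ⁺) (B ⁺) x ∘ ⊆-∪ʳ (↑ A) e̅ x)
  regroup : ∀ a b c → (a ℤ.- c) ℤ.+ (b ℤ.- c) ≡ (a ℤ.+ b) ℤ.- (c ℤ.+ c)
  regroup = solve 3 (λ a b c → (a :- c) :+ (b :- c) := (a :+ b) :- (c :+ c)) refl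

{-# OPTIONS --safe #-}

-- The star graph turns every κ into a component count on the vertex set
-- alone, where a map of vertices that respects connectivity and is onto up to
-- connectivity cannot increase the number of components.  Applied to collapse
-- and to a section of it, this gives κ_{H/e}(A) = κ_H(A ∪ e).  The case A = ∅
-- reads v(H/e) = κ_H({e}), so the two terms v(H) in the rank of P_H/e cancel.
module Submission where

open import Defs
open import Data.Bool.Base using (T)
open import Data.Bool.Properties using (T-∨; T-irrelevant)
open import Data.Empty using (⊥-elim)
open import Data.Integer.Base as ℤ using (+_)
open import Data.Integer.Solver using () renaming (module +-*-Solver to ℤ-Solver)
import Data.List.Membership.DecPropositional as DecMembership
open import Data.List.Membership.Propositional using (_∈_)
open import Data.List.Membership.Propositional.Properties using (∈-map⁺; ∈-map⁻)
open import Data.Nat.Base as ℕ using ()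
import Data.Nat.Properties as ℕₚ
open import Data.Product using (∃; _×_; _,_; proj₁; proj₂)
open import Data.Sum.Base using (inj₁; inj₂; [_,_]′)
open import Data.Unit.Base using (tt)
open import Function.Base using (_∘_; id)
open import Function.Bundles using (Equivalence)
open import Function.Construct.Identity using (↔-id)
open import Relation.Binary.Construct.Closure.Equivalence as EqC using ()
open import Relation.Binary.PropositionalEquality
  using (_≡_; refl; sym; trans; cong; cong₂; subst; subst₂; module ≡-Reasoning)
open import Relation.Nullary.Decidable
  using (yes; no; T?; decidable-stable; toWitness; fromWitness; toWitnessFalse; fromWitnessFalse)
open import Relation.Nullary.Negation using (contradiction)

open FiniteSet using (Carrier)

private
  variable
    V E V′ E′ : FiniteSet

≡⇒Connected : {X : Set} (G : Multigraph X) {x y : X} → x ≡ y → Connected G x y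
≡⇒Connected G refl = EqC.reflexive (Adjacent G)

-- Each edge of a star graph runs from the hub of a hyperedge to another of its elements, so
-- compatibility of `φ` need only be checked on pairs inside one hyperedge.
κ-≤ : (H : Hypergraph V E) (H′ : Hypergraph V′ E′) (φ : Carrier V → Carrier V′) →
      (∀ f {u w} → u ∈ edge H f → w ∈ edge H f → Connected (starGraph H′) (φ u) (φ w)) →
      (∀ y → ∃ λ x → Connected (starGraph H′) (φ x) y) →
      κ H′ ℕ.≤ κ H
κ-≤ {V = V} {V′ = V′} H H′ φ joins onto =
  subst₂ ℕ._≤_ (sym (κ-star H′)) (sym (κ-star H))
    (count-≤ (components V (starGraph H)) (components V′ (starGraph H′)) φ adjacent onto)
  where
  adjacent : ∀ {x y} → Adjacent (starGraph H) x y → Connected (starGraph H′) (φ x) (φ y)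
  adjacent p with star⁻ H p
  ... | f , u , u∈f , refl = joins f (proj₂ (hub H f)) u∈f

-- The index `f′` may be shared by several `f`, since parallel hyperedges do not affect
-- connectivity.
κ-≤-id : (H : Hypergraph V E) (H′ : Hypergraph V E′) →
         (∀ f → ∃ λ f′ → edge H f ≡ edge H′ f′) → κ H′ ℕ.≤ κ H
κ-≤-id H H′ embed = κ-≤ H H′ id joins (λ y → y , ≡⇒Connected (starGraph H′) refl)
  where
  joins : ∀ f {u w} → u ∈ edge H f → w ∈ edge H f → Connected (starGraph H′) u w
  joins f u∈f w∈f with embed f
  ... | f′ , eq = star-joins H′ f′ (subst (_ ∈_) eq u∈f) (subst (_ ∈_) eq w∈f)

-- The two index types differ only in how membership proofs are nested, so each hyperedge on one
-- side occurs unchanged on the other.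
κ-restrict-restrict : (H : Hypergraph V E) (B : Subset (Carrier E)) (A : Subset (∃ (T ∘ B))) →
                      κ (H ∣ B ∣ A) ≡ κ (H ∣ ↑[ B ] A)
κ-restrict-restrict H B A = ℕₚ.≤-antisym
  (κ-≤-id (H ∣ ↑[ B ] A) (H ∣ B ∣ A) λ (f , f∈) →
    let f∈B , f∈A = ∈-↑⁻ B A f f∈ in ((f , f∈B) , f∈A) , refl)
  (κ-≤-id (H ∣ B ∣ A) (H ∣ ↑[ B ] A) λ ((f , f∈B) , f∈A) →
    (f , ∈-↑⁺ B A f f∈B f∈A) , refl)

module _ {V E : FiniteSet} (H : Hypergraph V E) (e : Carrier E) where

  open DecMembership (FiniteSet._≟_ V) using (_∈?_)

  collapse-∈ : ∀ {u} → u ∈ edge H e → collapse H e u ≡ inj₂ tt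
  collapse-∈ {u} u∈e with T? (∁ (support H e) u)
  ... | yes u∉e = contradiction u∈e (toWitnessFalse u∉e)
  ... | no  _   = refl

  collapse-∉ : ∀ {u} (u∉e : T (∁ (support H e) u)) → collapse H e u ≡ inj₁ (u , u∉e)
  collapse-∉ {u} u∉e with T? (∁ (support H e) u)
  -- The proof found by `T?` need not be the given one, but membership proofs are unique.
  ... | yes u∉e′ = cong (λ p → inj₁ (u , p)) (T-irrelevant u∉e′ u∉e)
  ... | no ¬u∉e  = contradiction u∉e ¬u∉e

  -- A section of `collapse`. Any vertex of `e` could represent the new vertex; the hub is a choice
  -- at hand.
  expand : Carrier (contractedVertices H e) → Carrier V
  expand = [ proj₁ , (λ _ → proj₁ (hub H e)) ]′

  collapse-expand : ∀ y → collapse H e (expand y) ≡ y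
  collapse-expand (inj₁ (u , u∉e)) = collapse-∉ u∉e
  collapse-expand (inj₂ tt)        = collapse-∈ (proj₂ (hub H e))

  module _ (A : Subset (Carrier (E -ᶠ e))) where

    private
      A⁺ : Subset (Carrier E)
      A⁺ = ↑[ without E e ] A ∪ singleton E e
      G G/e : Multigraph _
      G   = starGraph (H ∣ A⁺)
      G/e = starGraph (H / e ∣ A)

    e∈A⁺ : T (A⁺ e)
    e∈A⁺ = ⊆-∪ʳ (↑[ without E e ] A) (singleton E e) e (fromWitness refl)

    -- Vertices outside `e` return to themselves; a vertex of `e` returns to the hub of `e`, to
    -- which it is joined because `e` belongs to `A⁺`.
    expand-collapse : ∀ u → Connected G (expand (collapse H e u)) u
    expand-collapse u with T? (∁ (support H e) u)
    ... | yes _   = ≡⇒Connected G refl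
    ... | no ¬u∉e = star-joins (H ∣ A⁺) (e , e∈A⁺) (proj₂ (hub H e)) (decidable-stable (u ∈? edge H e) (¬u∉e ∘ fromWitnessFalse))

    κ-contraction : κ (H / e ∣ A) ≡ κ (H ∣ A⁺)
    κ-contraction = ℕₚ.≤-antisym
      (κ-≤ (H ∣ A⁺) (H / e ∣ A) (collapse H e) collapse-joins
        (λ y → expand y , ≡⇒Connected G/e (collapse-expand y)))
      (κ-≤ (H / e ∣ A) (H ∣ A⁺) expand expand-joins
        (λ u → collapse H e u , expand-collapse u))
      where
      collapse-joins : ∀ f {u w} → u ∈ edge (H ∣ A⁺) f → w ∈ edge (H ∣ A⁺) f →
                       Connected G/e (collapse H e u) (collapse H e w)
      collapse-joins (f , f∈) u∈f w∈f
        with T-∨ {↑[ without E e ] A f} .Equivalence.to f∈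
      ... | inj₁ f∈↑A = let f≢e , f∈A = ∈-↑⁻ (without E e) A f f∈↑A in
        star-joins (H / e ∣ A) ((f , f≢e) , f∈A) (∈-map⁺ _ u∈f) (∈-map⁺ _ w∈f)
      -- Here the hyperedge is `e` itself, and all its vertices collapse to the new vertex.
      ... | inj₂ f∈e̅ with toWitness f∈e̅
      ...   | refl = ≡⇒Connected G/e (trans (collapse-∈ u∈f) (sym (collapse-∈ w∈f)))
      expand-joins : ∀ f {x y} → x ∈ edge (H / e ∣ A) f → y ∈ edge (H / e ∣ A) f →
                     Connected G (expand x) (expand y)
      expand-joins ((f , f≢e) , f∈A) x∈f y∈f
        with ∈-map⁻ (collapse H e) x∈f | ∈-map⁻ (collapse H e) y∈f
      -- Lift both vertices to `u` and `w` in the original hyperedge `f`, which joins them;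
      -- `expand-collapse` corrects the two ends.
      ... | u , u∈f , refl | w , w∈f , refl =
        Connected-trans G (expand-collapse u)
          (Connected-trans G
            (star-joins (H ∣ A⁺) (f , f∈A⁺) u∈f w∈f)
            (Connected-sym G (expand-collapse w)))
        where
        f∈A⁺ : T (A⁺ f)
        f∈A⁺ = ⊆-∪ˡ (↑[ without E e ] A) (singleton E e) f
          (∈-↑⁺ (without E e) A f f≢e f∈A)

  v-contraction : v (H / e) ≡ κ (H ∣ singleton E e)
  v-contraction = trans (sym (κ-∅ (H / e))) (trans (κ-contraction ∅)
    -- The two subsets agree pointwise but not definitionally, so antitonicity is used in both
    -- directions.
    (ℕₚ.≤-antisym (κ-antitone H e̅ (↑∅ ∪ e̅) (⊆-∪ʳ ↑∅ e̅))
                  (κ-antitone H (↑∅ ∪ e̅) e̅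
                    (∪-⊆ ↑∅ e̅ e̅ (λ x → ⊥-elim ∘ ↑-∅ (without E e) x) (λ _ → id)))))
    where
    e̅ = singleton E e
    ↑∅ = ↑[ without E e ] ∅

proposition4p1 : {V E : FiniteSet} (H : Hypergraph V E) (e : FiniteSet.Carrier E) →
    (P⟦ H ∖ e ⟧ ≐ P⟦ H ⟧ ∖ᴾ e) × (P⟦ H / e ⟧ ≅ P⟦ H ⟧ /ᴾ e)
-- Both groundsets are `E -ᶠ e`, so the identity serves as the bijection.
proposition4p1 {V} {E} H e = deletion , ↔-id _ , contraction
  where
  deletion : P⟦ H ∖ e ⟧ ≐ P⟦ H ⟧ ∖ᴾ e
  -- Deletion keeps the vertex set, so only the κ terms need comparison.
  deletion A = cong (λ k → + v H ℤ.- + k) (κ-restrict-restrict H (without E e) A)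

  cancel : ∀ n a b → a ℤ.- b ≡ (n ℤ.- b) ℤ.- (n ℤ.- a)
  cancel = solve 3 (λ n a b → a :- b := (n :- b) :- (n :- a)) refl
    where open ℤ-Solver using (solve; _:-_; _:=_)

  contraction : ∀ A → Polymatroid.rank P⟦ H / e ⟧ A ≡ Polymatroid.rank (P⟦ H ⟧ /ᴾ e) A
  contraction A = begin
    + v (H / e) ℤ.- + κ (H / e ∣ A)
      ≡⟨ cong₂ (λ m n → + m ℤ.- + n) (v-contraction H e) (κ-contraction H e A) ⟩
    + κ (H ∣ e̅) ℤ.- + κ (H ∣ A⁺)
      ≡⟨ cancel (+ v H) (+ κ (H ∣ e̅)) (+ κ (H ∣ A⁺)) ⟩
    (+ v H ℤ.- + κ (H ∣ A⁺)) ℤ.- (+ v H ℤ.- + κ (H ∣ e̅)) ∎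
    where
    open ≡-Reasoning
    e̅ A⁺ : Subset (Carrier E)
    e̅ = singleton E e
    A⁺ = ↑[ without E e ] A ∪ e̅
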